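{- Let $(\mathbf{A},\Box,\Diamond)$ be any finite Dunn GAO. Then $$(\mathbf{A},\Box,\Diamond)\cong(\mathbf{G}(\mathbf{F}_{\mathbf{A}}),\beta,\delta)\cong(\mathbf{G}(\mathbf{F}_{\mathbf{A}}),\beta_{R_{\mathbf{A}}},\delta_{R_{\mathbf{A}}})$$ via the same isomorphism $r:A\to G(\mathbf{F}_{\mathbf{A}})$, $r(a)=\{f\in F_{\mathbf{A}}\mid a\in f\}$. In particular, for all $a\in A$, $$r(\Box a)=\beta(r(a))=\beta_{R_{\mathbf{A}}}(r(a))\quad\text{and}\quad r(\Diamond a)=\delta(r(a))=\delta_{R_{\mathbf{A}}}(r(a)).$$
   Context: A G\"odel algebra is a Heyting algebra $\mathbf{A}=(A,\wedge,\vee,\to,\bot,\top)$ satisfying prelinearity $(a\to b)\vee(b\to a)=\top$. A GAO (G\"odel algebra with operators) is a triple $(\mathbf{A},\Box,\Diamond)$ with $\mathbf{A}$ a G\"odel algebra and $\Box,\Diamond:A\to A$ satisfying $\Box\top=\top$, $\Box(x\wedge y)=\Box x\wedge\Box y$, $\Diamond\bot=\bot$, $\Diamond(x\vee y)=\Diamond x\vee\Diamond y$. A Dunn GAO is a GAO satisfying, for all $a,b$: $\Box(a\vee b)\leq\Box a\vee\Diamond b$ and $\Box a\wedge\Diamond b\leq\Diamond(a\wedge b)$. A forest is a finite poset in which the downset of each element is totally ordered. For a finite G\"odel algebra $\mathbf{A}$, $F_{\mathbf{A}}$ is the set of its prime (proper) filters, ordered by $f_1\leq f_2$ iff $f_1\supseteq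 f_2$; $\mathbf{F}_{\mathbf{A}}=(F_{\mathbf{A}},\leq)$ is a finite forest. For a finite forest $\mathbf{F}=(F,\leq)$, $G(\mathbf{F})$ is the set of all downward closed subsets of $F$, and $\mathbf{G}(\mathbf{F})=(G(\mathbf{F}),\cap,\cup,\to,\emptyset,F)$ with $x\to y=F\setminus{\uparrow}(x\setminus y)$, which is a G\"odel algebra. On $F_{\mathbf{A}}$ define: $f_1R_\Box f_2$ iff $\Box^{ -1}(f_1)\subseteq f_2$; $f_1R_\Diamond f_2$ iff $f_2\subseteq\Diamond^{ -1}(f_1)$; and $R_{\mathbf{A}}=R_\Box\cap R_\Diamond$. For $a\in G(\mathbf{F}_{\mathbf{A}})$ and a relation $S$ on $F_{\mathbf{A}}$ let $\beta_S(a)=\{y\in F_{\mathbf{A}}\mid\forall z\in F_{\mathbf{A}},\ (ySz\Rightarrow z\in a)\}$ and $\delta_S(a)=\{y\in F_{\mathbf{A}}\mid\exists z\in a,\ ySz\}$. Put $\beta=\beta_{R_\Box}$ and $\delta=\delta_{R_\Diamond}$. -}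

module Defs where

open import Level using (_⊔_; 0ℓ) renaming (suc to lsuc)
open import Algebra.Core using (Op₁; Op₂)
open import Algebra.Lattice.Bundles using (RawLattice)
open import Algebra.Lattice.Morphism.Structures using (IsLatticeIsomorphism)
open import Data.Bool.Base using (Bool; T)
open import Data.Bool.Properties using (T?)
open import Data.List.Base using (List; []; _∷_)
open import Data.List.Relation.Unary.Any using (Any; here; there; any?)
open import Data.List.Relation.Unary.Enumerates.Setoid using (IsEnumeration)
import Data.List.Membership.Setoid as ListMembership
open import Data.Product.Base using (∃; ∃-syntax; _×_; _,_; proj₁; proj₂)
open import Data.Sum.Base using (_⊎_; inj₁; inj₂; [_,_]′)
import Data.Sum.Base as Sum
open import Function.Base using (_∘_; id; flip)
open import Relation.Binary.Bundles using (Setoid; Poset; DecPoset)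
open import Relation.Binary.Core using (Rel; _Preserves_⟶_)
open import Relation.Binary.Definitions using (_Respects₂_) renaming (Decidable to Decidable₂)
open import Relation.Binary.Lattice.Bundles using (HeytingAlgebra)
open import Relation.Nullary.Decidable
  using (Dec; yes; no; isYes; map′; toWitness; fromWitness; ¬?; _×-dec_; _⊎-dec_; _→-dec_; decidable-stable)
open import Relation.Nullary.Negation using (¬_; contradiction)
open import Relation.Unary
  using (Pred; Decidable; _∈_; _∉_; _⊆′_; _⊇′_; _≐′_; _⊢_; _∩_; _∪_; _∖_; ∁; ∅; U)

-- The enumeration may contain repetitions; together with decidable equality
-- this amounts to a bijection with some Fin n.

record IsFinite {a ℓ} (S : Setoid a ℓ) : Set (a ⊔ ℓ) where
  open Setoid S
  field
    _≟_      : Decidable₂ _≈_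
    elements : List Carrier
    complete : IsEnumeration S elements

module Search {a ℓ} (S : Setoid a ℓ)
              (xs : List (Setoid.Carrier S)) (complete : IsEnumeration S xs) where
  open Setoid S
  open ListMembership S using (find; lose)

  ∃? : ∀ {p} {P : Pred Carrier p} → (∀ {x y} → x ≈ y → P x → P y) →
       Decidable P → Dec (∃ P)
  ∃? {P = P} resp P? = map′ to from (any? P? xs)
    where
    to : Any P xs → ∃ P
    to p = let x , _ , px = find p in x , px
    from : ∃ P → Any P xs
    from (x , px) = lose resp (complete x) px

  ∀? : ∀ {p} {P : Pred Carrier p} → (∀ {x y} → x ≈ y → P x → P y) →
       Decidable P → Dec (∀ x → P x)
  ∀? resp P? = map′
    (λ ¬∃¬ x → decidable-stable (P? x) (λ ¬px → ¬∃¬ (x , ¬px)))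
    (λ all (x , ¬px) → ¬px (all x))
    (¬? (∃? (λ x≈y ¬px py → ¬px (resp (sym x≈y) py)) (¬? ∘ P?)))

record GödelAlgebra c ℓ₁ ℓ₂ : Set (lsuc (c ⊔ ℓ₁ ⊔ ℓ₂)) where
  field
    heytingAlgebra : HeytingAlgebra c ℓ₁ ℓ₂

  open HeytingAlgebra heytingAlgebra public

  field
    prelinearity : ∀ a b → (a ⇨ b) ∨ (b ⇨ a) ≈ ⊤

record GAO c ℓ₁ ℓ₂ : Set (lsuc (c ⊔ ℓ₁ ⊔ ℓ₂)) where
  field
    gödelAlgebra : GödelAlgebra c ℓ₁ ℓ₂

  open GödelAlgebra gödelAlgebra public

  infix 8 □_ ◇_
  field
    □_     : Op₁ Carrier
    ◇_     : Op₁ Carrier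
    □-cong : □_ Preserves _≈_ ⟶ _≈_
    ◇-cong : ◇_ Preserves _≈_ ⟶ _≈_
    □-⊤    : □ ⊤ ≈ ⊤
    □-∧    : ∀ x y → □ (x ∧ y) ≈ □ x ∧ □ y
    ◇-⊥    : ◇ ⊥ ≈ ⊥
    ◇-∨    : ∀ x y → ◇ (x ∨ y) ≈ ◇ x ∨ ◇ y

  rawLattice : RawLattice c ℓ₁
  rawLattice = record { _≈_ = _≈_ ; _∧_ = _∧_ ; _∨_ = _∨_ }

record IsDunn {c ℓ₁ ℓ₂} (𝐀 : GAO c ℓ₁ ℓ₂) : Set (c ⊔ ℓ₂) where
  open GAO 𝐀
  field
    □-dunn : ∀ a b → □ (a ∨ b) ≤ □ a ∨ ◇ b
    ◇-dunn : ∀ a b → □ a ∧ ◇ b ≤ ◇ (a ∧ b)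

record IsGAOIsomorphism {c ℓ₁ ℓ₂ c′ ℓ₁′ ℓ₂′} (𝐀 : GAO c ℓ₁ ℓ₂) (𝐁 : GAO c′ ℓ₁′ ℓ₂′)
                        (h : GAO.Carrier 𝐀 → GAO.Carrier 𝐁)
                        : Set (c ⊔ ℓ₁ ⊔ c′ ⊔ ℓ₁′) where
  private
    module A = GAO 𝐀
    module B = GAO 𝐁
  field
    isLatticeIsomorphism : IsLatticeIsomorphism A.rawLattice B.rawLattice h
    ⇨-homo : ∀ x y → h (x A.⇨ y) B.≈ h x B.⇨ h y
    ⊥-homo : h A.⊥ B.≈ B.⊥
    ⊤-homo : h A.⊤ B.≈ B.⊤
    □-homo : ∀ x → h (A.□ x) B.≈ B.□ h x
    ◇-homo : ∀ x → h (A.◇ x) B.≈ B.◇ h x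

record Forest c ℓ₁ ℓ₂ : Set (lsuc (c ⊔ ℓ₁ ⊔ ℓ₂)) where
  field
    decPoset : DecPoset c ℓ₁ ℓ₂

  open DecPoset decPoset public

  field
    finite : IsFinite Eq.setoid
    chain  : ∀ {x y z} → y ≤ x → z ≤ x → y ≤ z ⊎ z ≤ y

  open IsFinite finite public using (elements; complete)

-- Classically every relation is decidable; here decidability is what makes
-- the subsets that the relation induces on the (finite) forest decidable.

record Relation {c ℓ₁ ℓ₂} (𝐅 : Forest c ℓ₁ ℓ₂) ℓ : Set (c ⊔ ℓ₁ ⊔ lsuc ℓ) where
  open Forest 𝐅
  field
    rel  : Rel Carrier ℓ
    dec  : Decidable₂ rel
    resp : rel Respects₂ _≈_

_∩ʳ_ : ∀ {c ℓ₁ ℓ₂ ℓ ℓ′} {𝐅 : Forest c ℓ₁ ℓ₂} →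
       Relation 𝐅 ℓ → Relation 𝐅 ℓ′ → Relation 𝐅 (ℓ ⊔ ℓ′)
S ∩ʳ S′ = record
  { rel  = λ x y → S.rel x y × S′.rel x y
  ; dec  = λ x y → S.dec x y ×-dec S′.dec x y
  ; resp = (λ e (s , s′) → proj₁ S.resp e s , proj₁ S′.resp e s′)
         , (λ e (s , s′) → proj₂ S.resp e s , proj₂ S′.resp e s′)
  }
  where
  module S  = Relation S
  module S′ = Relation S′

module Downsets {c ℓ₁ ℓ₂} (𝐅 : Forest c ℓ₁ ℓ₂) where
  open Forest 𝐅
  open Search Eq.setoid elements complete

  DownClosed : ∀ {p} → Pred Carrier p → Set (c ⊔ ℓ₂ ⊔ p)
  DownClosed P = ∀ {x y} → x ≤ y → y ∈ P → x ∈ P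

  ↑ : ∀ {p} → Pred Carrier p → Pred Carrier (c ⊔ ℓ₂ ⊔ p)
  ↑ P y = ∃[ x ] x ∈ P × x ≤ y

  -- A subset of a finite set is given by its characteristic function.  With
  -- arbitrary Set-valued predicates, a finite algebra could not in general be shown
  -- isomorphic to an algebra of downsets without excluded middle.

  record Downset : Set (c ⊔ ℓ₂) where
    field
      χ : Carrier → Bool

    ⟦_⟧ : Pred Carrier 0ℓ
    ⟦_⟧ x = T (χ x)

    field
      downClosed : DownClosed ⟦_⟧

  open Downset public using (⟦_⟧)

  ⟦_⟧? : ∀ a → Decidable ⟦ a ⟧
  ⟦ a ⟧? x = T? (Downset.χ a x)

  ⟦_⟧-resp : ∀ a {x y} → x ≈ y → x ∈ ⟦ a ⟧ → y ∈ ⟦ a ⟧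
  ⟦ a ⟧-resp x≈y = Downset.downClosed a (reflexive (Eq.sym x≈y))

  module _ {p} (P : Pred Carrier p) (P? : Decidable P) (P↓ : DownClosed P) where

    downset : Downset
    downset = record
      { χ          = λ x → isYes (P? x)
      ; downClosed = λ {x} {y} x≤y y∈ →
          fromWitness {a? = P? x} (P↓ x≤y (toWitness {a? = P? y} y∈))
      }

    downset⁻ : ⟦ downset ⟧ ⊆′ P
    downset⁻ x = toWitness {a? = P? x}

    downset⁺ : P ⊆′ ⟦ downset ⟧
    downset⁺ x = fromWitness {a? = P? x}

  _≈ᴳ_ : Rel Downset c
  a ≈ᴳ b = ⟦ a ⟧ ≐′ ⟦ b ⟧

  _≤ᴳ_ : Rel Downset c
  a ≤ᴳ b = ⟦ a ⟧ ⊆′ ⟦ b ⟧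

  ∩↓ : ∀ a b → DownClosed (⟦ a ⟧ ∩ ⟦ b ⟧)
  ∩↓ a b x≤y (p , q) = Downset.downClosed a x≤y p , Downset.downClosed b x≤y q

  ∪↓ : ∀ a b → DownClosed (⟦ a ⟧ ∪ ⟦ b ⟧)
  ∪↓ a b x≤y = Sum.map (Downset.downClosed a x≤y) (Downset.downClosed b x≤y)

  ∩? : ∀ a b → Decidable (⟦ a ⟧ ∩ ⟦ b ⟧)
  ∩? a b x = ⟦ a ⟧? x ×-dec ⟦ b ⟧? x

  ∪? : ∀ a b → Decidable (⟦ a ⟧ ∪ ⟦ b ⟧)
  ∪? a b x = ⟦ a ⟧? x ⊎-dec ⟦ b ⟧? x

  ⇨↓ : ∀ a b → DownClosed (∁ (↑ (⟦ a ⟧ ∖ ⟦ b ⟧)))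
  ⇨↓ a b x≤y y∉ (z , z∈ , z≤x) = y∉ (z , z∈ , trans z≤x x≤y)

  ⇨? : ∀ a b → Decidable (∁ (↑ (⟦ a ⟧ ∖ ⟦ b ⟧)))
  ⇨? a b y = ¬? (∃?
    (λ x≈z ((x∈a , x∉b) , x≤y) →
      (⟦ a ⟧-resp x≈z x∈a , x∉b ∘ ⟦ b ⟧-resp (Eq.sym x≈z))
      , trans (reflexive (Eq.sym x≈z)) x≤y)
    (λ x → (⟦ a ⟧? x ×-dec ¬? (⟦ b ⟧? x)) ×-dec (x ≤? y)))

  _∩ᴳ_ : Op₂ Downset
  a ∩ᴳ b = downset (⟦ a ⟧ ∩ ⟦ b ⟧) (∩? a b) (∩↓ a b)

  _∪ᴳ_ : Op₂ Downset
  a ∪ᴳ b = downset (⟦ a ⟧ ∪ ⟦ b ⟧) (∪? a b) (∪↓ a b)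

  _⇨ᴳ_ : Op₂ Downset
  a ⇨ᴳ b = downset (∁ (↑ (⟦ a ⟧ ∖ ⟦ b ⟧))) (⇨? a b) (⇨↓ a b)

  ∅ᴳ : Downset
  ∅ᴳ = downset ∅ (λ _ → no (λ ())) (λ _ ())

  Uᴳ : Downset
  Uᴳ = downset U (λ _ → yes _) (λ _ _ → _)

  ∩⁻ : ∀ a b → ⟦ a ∩ᴳ b ⟧ ⊆′ (⟦ a ⟧ ∩ ⟦ b ⟧)
  ∩⁻ a b = downset⁻ _ (∩? a b) (∩↓ a b)

  ∩⁺ : ∀ a b → (⟦ a ⟧ ∩ ⟦ b ⟧) ⊆′ ⟦ a ∩ᴳ b ⟧
  ∩⁺ a b = downset⁺ _ (∩? a b) (∩↓ a b)

  ∪⁻ : ∀ a b → ⟦ a ∪ᴳ b ⟧ ⊆′ (⟦ a ⟧ ∪ ⟦ b ⟧)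
  ∪⁻ a b = downset⁻ _ (∪? a b) (∪↓ a b)

  ∪⁺ : ∀ a b → (⟦ a ⟧ ∪ ⟦ b ⟧) ⊆′ ⟦ a ∪ᴳ b ⟧
  ∪⁺ a b = downset⁺ _ (∪? a b) (∪↓ a b)

  ⇨⁻ : ∀ a b → ⟦ a ⇨ᴳ b ⟧ ⊆′ ∁ (↑ (⟦ a ⟧ ∖ ⟦ b ⟧))
  ⇨⁻ a b = downset⁻ _ (⇨? a b) (⇨↓ a b)

  ⇨⁺ : ∀ a b → ∁ (↑ (⟦ a ⟧ ∖ ⟦ b ⟧)) ⊆′ ⟦ a ⇨ᴳ b ⟧
  ⇨⁺ a b = downset⁺ _ (⇨? a b) (⇨↓ a b)

  heytingAlgebra : HeytingAlgebra (c ⊔ ℓ₂) c c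
  heytingAlgebra = record
    { Carrier = Downset
    ; _≈_ = _≈ᴳ_
    ; _≤_ = _≤ᴳ_
    ; _∨_ = _∪ᴳ_
    ; _∧_ = _∩ᴳ_
    ; _⇨_ = _⇨ᴳ_
    ; ⊤   = Uᴳ
    ; ⊥   = ∅ᴳ
    ; isHeytingAlgebra = record
      { isBoundedLattice = record
        { isLattice = record
          { isPartialOrder = record
            { isPreorder = record
              { isEquivalence = record
                { refl  = (λ _ → id) , (λ _ → id)
                ; sym   = λ (p , q) → q , p
                ; trans = λ (p , q) (p′ , q′) → (λ x → p′ x ∘ p x) , (λ x → q x ∘ q′ x)
                }
              ; reflexive = proj₁
              ; trans     = λ p q x → q x ∘ p x
              }
            ; antisym = _,_
            }
          ; supremum = λ a b → (λ x → ∪⁺ a b x ∘ inj₁)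
                             , (λ x → ∪⁺ a b x ∘ inj₂)
                             , (λ _ p q x → [ p x , q x ]′ ∘ ∪⁻ a b x)
          ; infimum  = λ a b → (λ x → proj₁ ∘ ∩⁻ a b x)
                             , (λ x → proj₂ ∘ ∩⁻ a b x)
                             , (λ _ p q x x∈ → ∩⁺ a b x (p x x∈ , q x x∈))
          }
        ; maximum = λ _ _ _ → _
        ; minimum = λ _ _ ()
        }
      ; exponential = λ w a b →
            (λ w∩a≤b x x∈w → ⇨⁺ a b x λ (z , (z∈a , z∉b) , z≤x) →
               z∉b (w∩a≤b z (∩⁺ w a z (Downset.downClosed w z≤x x∈w , z∈a))))
          , (λ w≤a⇨b x x∈ → let x∈w , x∈a = ∩⁻ w a x x∈ in
               decidable-stable (⟦ b ⟧? x) λ x∉b →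
                 ⇨⁻ a b x (w≤a⇨b x x∈w) (x , (x∈a , x∉b) , refl))
      }
    }

  gödelAlgebra : GödelAlgebra (c ⊔ ℓ₂) c c
  gödelAlgebra = record
    { heytingAlgebra = heytingAlgebra
    ; prelinearity   = λ a b → (λ _ _ → _) , λ x _ →
        decidable-stable (⟦ (a ⇨ᴳ b) ∪ᴳ (b ⇨ᴳ a) ⟧? x) λ x∉ →
          x∉ (∪⁺ (a ⇨ᴳ b) (b ⇨ᴳ a) x (inj₁ (⇨⁺ a b x λ p →
          x∉ (∪⁺ (a ⇨ᴳ b) (b ⇨ᴳ a) x (inj₂ (⇨⁺ b a x λ q → incompatible a b p q))))))
    }
    where
    incompatible : ∀ a b {x} → x ∈ ↑ (⟦ a ⟧ ∖ ⟦ b ⟧) → ¬ (x ∈ ↑ (⟦ b ⟧ ∖ ⟦ a ⟧))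
    incompatible a b (y , (y∈a , y∉b) , y≤x) (z , (z∈b , z∉a) , z≤x) =
      [ (λ y≤z → y∉b (Downset.downClosed b y≤z z∈b))
      , (λ z≤y → z∉a (Downset.downClosed a z≤y y∈a)) ]′ (chain y≤x z≤x)

  β : ∀ {ℓ} → Relation 𝐅 ℓ → Downset → Pred Carrier (c ⊔ ℓ)
  β S a y = ∀ z → Relation.rel S y z → z ∈ ⟦ a ⟧

  δ : ∀ {ℓ} → Relation 𝐅 ℓ → Downset → Pred Carrier (c ⊔ ℓ)
  δ S a y = ∃[ z ] z ∈ ⟦ a ⟧ × Relation.rel S y z

  -- For an arbitrary relation, β and δ need not send downsets to downsets.

  record Stable {ℓ ℓ′} (S : Relation 𝐅 ℓ) (S′ : Relation 𝐅 ℓ′)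
                : Set (c ⊔ ℓ₂ ⊔ ℓ ⊔ ℓ′) where
    field
      β↓ : ∀ a → DownClosed (β S a)
      δ↓ : ∀ a → DownClosed (δ S′ a)

  module _ {ℓ ℓ′} (S : Relation 𝐅 ℓ) (S′ : Relation 𝐅 ℓ′) (stable : Stable S S′) where
    private
      module S  = Relation S
      module S′ = Relation S′
    open Stable stable

    β? : ∀ a → Decidable (β S a)
    β? a y = ∀?
      (λ x≈z f s → ⟦ a ⟧-resp x≈z (f (proj₁ S.resp (Eq.sym x≈z) s)))
      (λ z → S.dec y z →-dec ⟦ a ⟧? z)

    δ? : ∀ a → Decidable (δ S′ a)
    δ? a y = ∃?
      (λ x≈z (x∈a , s) → ⟦ a ⟧-resp x≈z x∈a , proj₁ S′.resp x≈z s)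
      (λ z → ⟦ a ⟧? z ×-dec S′.dec y z)

    βᴳ : Op₁ Downset
    βᴳ a = downset (β S a) (β? a) (β↓ a)

    δᴳ : Op₁ Downset
    δᴳ a = downset (δ S′ a) (δ? a) (δ↓ a)

    βᴳ⁻ : ∀ a → ⟦ βᴳ a ⟧ ⊆′ β S a
    βᴳ⁻ a = downset⁻ _ (β? a) (β↓ a)

    βᴳ⁺ : ∀ a → β S a ⊆′ ⟦ βᴳ a ⟧
    βᴳ⁺ a = downset⁺ _ (β? a) (β↓ a)

    δᴳ⁻ : ∀ a → ⟦ δᴳ a ⟧ ⊆′ δ S′ a
    δᴳ⁻ a = downset⁻ _ (δ? a) (δ↓ a)

    δᴳ⁺ : ∀ a → δ S′ a ⊆′ ⟦ δᴳ a ⟧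
    δᴳ⁺ a = downset⁺ _ (δ? a) (δ↓ a)

    β-mono : ∀ {a b} → a ≤ᴳ b → βᴳ a ≤ᴳ βᴳ b
    β-mono {a} {b} a≤b y y∈ = βᴳ⁺ b y (λ z s → a≤b z (βᴳ⁻ a y y∈ z s))

    δ-mono : ∀ {a b} → a ≤ᴳ b → δᴳ a ≤ᴳ δᴳ b
    δ-mono {a} {b} a≤b y y∈ =
      let z , z∈a , s = δᴳ⁻ a y y∈ in δᴳ⁺ b y (z , a≤b z z∈a , s)

    complexGAO : GAO (c ⊔ ℓ₂) c c
    complexGAO = record
      { gödelAlgebra = gödelAlgebra
      ; □_     = βᴳ
      ; ◇_     = δᴳ
      ; □-cong = λ {a} {b} (p , q) → β-mono {a} {b} p , β-mono {b} {a} q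
      ; ◇-cong = λ {a} {b} (p , q) → δ-mono {a} {b} p , δ-mono {b} {a} q
      ; □-⊤    = (λ _ _ → _) , (λ y _ → βᴳ⁺ Uᴳ y (λ _ _ → _))
      ; □-∧    = λ a b →
          (λ y y∈ → let f = βᴳ⁻ (a ∩ᴳ b) y y∈ in
            ∩⁺ (βᴳ a) (βᴳ b) y
              ( βᴳ⁺ a y (λ z s → proj₁ (∩⁻ a b z (f z s)))
              , βᴳ⁺ b y (λ z s → proj₂ (∩⁻ a b z (f z s)))))
        , (λ y y∈ → let p , q = ∩⁻ (βᴳ a) (βᴳ b) y y∈ in
            βᴳ⁺ (a ∩ᴳ b) y (λ z s → ∩⁺ a b z (βᴳ⁻ a y p z s , βᴳ⁻ b y q z s)))
      ; ◇-⊥    = (λ y y∈ → proj₁ (proj₂ (δᴳ⁻ ∅ᴳ y y∈))) , (λ _ ())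
      ; ◇-∨    = λ a b →
          (λ y y∈ → let z , z∈ , s = δᴳ⁻ (a ∪ᴳ b) y y∈ in
            ∪⁺ (δᴳ a) (δᴳ b) y
              (Sum.map (λ p → δᴳ⁺ a y (z , p , s)) (λ q → δᴳ⁺ b y (z , q , s))
                (∪⁻ a b z z∈)))
        , (λ y → [ δ-mono {a} {a ∪ᴳ b} (λ z → ∪⁺ a b z ∘ inj₁) y
                 , δ-mono {b} {a ∪ᴳ b} (λ z → ∪⁺ a b z ∘ inj₂) y ]′
                 ∘ ∪⁻ (δᴳ a) (δᴳ b) y)
      }

module PrimeFilters {c ℓ₁ ℓ₂} (𝐀 : GödelAlgebra c ℓ₁ ℓ₂)
                    (finite : IsFinite (GödelAlgebra.setoid 𝐀)) where
  open GödelAlgebra 𝐀 hiding (poset)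
  open IsFinite finite
  open Search setoid elements complete
  private
    module M = ListMembership setoid

  -- Filters, too, are given by characteristic functions, and are proper.

  record PrimeFilter : Set (c ⊔ ℓ₂) where
    field
      χ : Carrier → Bool

    ⟪_⟫ : Pred Carrier 0ℓ
    ⟪_⟫ x = T (χ x)

    field
      ⊤∈       : ⊤ ∈ ⟪_⟫
      upClosed : ∀ {x y} → x ≤ y → x ∈ ⟪_⟫ → y ∈ ⟪_⟫
      ∧-closed : ∀ {x y} → x ∈ ⟪_⟫ → y ∈ ⟪_⟫ → x ∧ y ∈ ⟪_⟫
      ⊥∉       : ⊥ ∉ ⟪_⟫
      prime    : ∀ {x y} → x ∨ y ∈ ⟪_⟫ → x ∈ ⟪_⟫ ⊎ y ∈ ⟪_⟫

  open PrimeFilter public using (⟪_⟫)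

  ⟪_⟫? : ∀ f → Decidable ⟪ f ⟫
  ⟪ f ⟫? x = T? (PrimeFilter.χ f x)

  ⟪_⟫-resp : ∀ f {x y} → x ≈ y → x ∈ ⟪ f ⟫ → y ∈ ⟪ f ⟫
  ⟪ f ⟫-resp x≈y = PrimeFilter.upClosed f (reflexive x≈y)

  _≈ꟳ_ : Rel PrimeFilter c
  f ≈ꟳ g = ⟪ f ⟫ ≐′ ⟪ g ⟫

  _≤ꟳ_ : Rel PrimeFilter c
  f ≤ꟳ g = ⟪ f ⟫ ⊇′ ⟪ g ⟫

  poset : Poset (c ⊔ ℓ₂) c c
  poset = record
    { Carrier = PrimeFilter
    ; _≈_     = _≈ꟳ_
    ; _≤_     = _≤ꟳ_
    ; isPartialOrder = record
      { isPreorder = record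
        { isEquivalence = record
          { refl  = (λ _ → id) , (λ _ → id)
          ; sym   = λ (p , q) → q , p
          ; trans = λ (p , q) (p′ , q′) → (λ x → p′ x ∘ p x) , (λ x → q x ∘ q′ x)
          }
        ; reflexive = proj₂
        ; trans     = λ p q x → p x ∘ q x
        }
      ; antisym = flip _,_
      }
    }

  _≤ꟳ?_ : Decidable₂ _≤ꟳ_
  f ≤ꟳ? g = ∀?
    (λ x≈y h → ⟪ f ⟫-resp x≈y ∘ h ∘ ⟪ g ⟫-resp (Eq.sym x≈y))
    (λ x → ⟪ g ⟫? x →-dec ⟪ f ⟫? x)

  decPoset : DecPoset (c ⊔ ℓ₂) c c
  decPoset = record
    { isDecPartialOrder = record
      { isPartialOrder = Poset.isPartialOrder poset
      ; _≟_  = λ f g → (g ≤ꟳ? f) ×-dec (f ≤ꟳ? g)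
      ; _≤?_ = _≤ꟳ?_
      }
    }

  -- Every filter of a finite lattice is principal, so the prime filters are
  -- found by testing each element for being join-prime.

  _≤?_ : Decidable₂ _≤_
  x ≤? y = map′
    (λ x≈x∧y → trans (reflexive x≈x∧y) (x∧y≤y x y))
    (λ x≤y → antisym (∧-greatest refl x≤y) (x∧y≤x x y))
    (x ≟ (x ∧ y))

  ≤-respʳ : ∀ {p x y} → x ≈ y → p ≤ x → p ≤ y
  ≤-respʳ x≈y p≤x = trans p≤x (reflexive x≈y)

  ∨-mono : ∀ {x y x′ y′} → x ≤ x′ → y ≤ y′ → x ∨ y ≤ x′ ∨ y′
  ∨-mono x≤ y≤ = ∨-least (trans x≤ (x≤x∨y _ _)) (trans y≤ (y≤x∨y _ _))

  JoinPrime : Pred Carrier (c ⊔ ℓ₂)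
  JoinPrime p = ¬ (p ≤ ⊥) × (∀ x y → p ≤ x ∨ y → p ≤ x ⊎ p ≤ y)

  joinPrime? : Decidable JoinPrime
  joinPrime? p = ¬? (p ≤? ⊥) ×-dec
    ∀? (λ x≈x′ h y p≤ →
          Sum.map₁ (≤-respʳ x≈x′)
            (h y (trans p≤ (∨-mono (reflexive (Eq.sym x≈x′)) refl))))
       (λ x → ∀? (λ y≈y′ h p≤ →
                    Sum.map₂ (≤-respʳ y≈y′)
                      (h (trans p≤ (∨-mono refl (reflexive (Eq.sym y≈y′))))))
                 (λ y → (p ≤? (x ∨ y)) →-dec ((p ≤? x) ⊎-dec (p ≤? y))))

  principal : ∀ p → JoinPrime p → PrimeFilter
  principal p (p≰⊥ , pr) = record
    { χ        = λ x → isYes (p ≤? x)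
    ; ⊤∈       = into (maximum p)
    ; upClosed = λ x≤y x∈ → into (trans (out x∈) x≤y)
    ; ∧-closed = λ x∈ y∈ → into (∧-greatest (out x∈) (out y∈))
    ; ⊥∉       = λ ⊥∈ → p≰⊥ (out ⊥∈)
    ; prime    = λ x∨y∈ → Sum.map into into (pr _ _ (out x∨y∈))
    }
    where
    into : ∀ {x} → p ≤ x → T (isYes (p ≤? x))
    into {x} = fromWitness {a? = p ≤? x}
    out : ∀ {x} → T (isYes (p ≤? x)) → p ≤ x
    out {x} = toWitness {a? = p ≤? x}

  principals : List Carrier → List PrimeFilter
  principals [] = []
  principals (p ∷ ps) with joinPrime? p
  ... | yes jp = principal p jp ∷ principals ps
  ... | no _   = principals ps

  module _ (f : PrimeFilter) where
    open PrimeFilter f using (⊤∈; upClosed; ∧-closed; ⊥∉; prime)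

    meet : List Carrier → Carrier
    meet [] = ⊤
    meet (x ∷ xs) with ⟪ f ⟫? x
    ... | yes _ = x ∧ meet xs
    ... | no _  = meet xs

    meet∈ : ∀ xs → meet xs ∈ ⟪ f ⟫
    meet∈ [] = ⊤∈
    meet∈ (x ∷ xs) with ⟪ f ⟫? x
    ... | yes x∈ = ∧-closed x∈ (meet∈ xs)
    ... | no _   = meet∈ xs

    meet≤ : ∀ {x} xs → x M.∈ xs → x ∈ ⟪ f ⟫ → meet xs ≤ x
    meet≤ (y ∷ ys) x∈ys x∈f with ⟪ f ⟫? y
    meet≤ (y ∷ ys) (here x≈y)   x∈f | yes _  = trans (x∧y≤x _ _) (reflexive (Eq.sym x≈y))
    meet≤ (y ∷ ys) (there x∈ys) x∈f | yes _  = trans (x∧y≤y _ _) (meet≤ ys x∈ys x∈f)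
    meet≤ (y ∷ ys) (here x≈y)   x∈f | no y∉f = contradiction (⟪ f ⟫-resp x≈y x∈f) y∉f
    meet≤ (y ∷ ys) (there x∈ys) x∈f | no _   = meet≤ ys x∈ys x∈f

    Generates : Pred Carrier (c ⊔ ℓ₂)
    Generates p = p ∈ ⟪ f ⟫ × (∀ {x} → x ∈ ⟪ f ⟫ → p ≤ x)

    generates⇒joinPrime : ∀ {p} → Generates p → JoinPrime p
    generates⇒joinPrime (p∈ , p≤) =
        (λ p≤⊥ → ⊥∉ (upClosed p≤⊥ p∈))
      , (λ _ _ p≤x∨y → Sum.map p≤ p≤ (prime (upClosed p≤x∨y p∈)))

    principals-complete : ∀ ps → Any Generates ps → Any (f ≈ꟳ_) (principals ps)
    principals-complete (p ∷ ps) g with joinPrime? p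
    principals-complete (p ∷ ps) (here (p∈ , p≤)) | yes _ = here
      ( (λ x x∈ → fromWitness {a? = p ≤? x} (p≤ x∈))
      , (λ x x∈ → upClosed (toWitness {a? = p ≤? x} x∈) p∈))
    principals-complete (p ∷ ps) (there g) | yes _  = there (principals-complete ps g)
    principals-complete (p ∷ ps) (here g)  | no ¬jp = contradiction (generates⇒joinPrime g) ¬jp
    principals-complete (p ∷ ps) (there g) | no _   = principals-complete ps g

    generator : Any Generates elements
    generator = M.lose
      (λ p≈q (p∈ , p≤) → ⟪ f ⟫-resp p≈q p∈
                       , λ x∈ → trans (reflexive (Eq.sym p≈q)) (p≤ x∈))
      (complete (meet elements))
      (meet∈ elements , λ {x} → meet≤ elements (complete x))

  comparable : ∀ f g h → g ≤ꟳ f → h ≤ꟳ f → g ≤ꟳ h ⊎ h ≤ꟳ g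
  comparable f g h g≤f h≤f with g ≤ꟳ? h | h ≤ꟳ? g
  ... | yes g≤h | _       = inj₁ g≤h
  ... | no _    | yes h≤g = inj₂ h≤g
  ... | no g≰h  | no h≰g  = contradiction
    (λ x x∈h → decidable-stable (⟪ g ⟫? x) λ x∉g →
      h≰g (λ y y∈g → decidable-stable (⟪ h ⟫? y) λ y∉h →
        [ (λ x⇨y∈ → y∉h (detach h (h≤f _ x⇨y∈) x∈h))
        , (λ y⇨x∈ → x∉g (detach g (g≤f _ y⇨x∈) y∈g)) ]′
        (PrimeFilter.prime f
          (⟪ f ⟫-resp (Eq.sym (prelinearity x y)) (PrimeFilter.⊤∈ f)))))
    g≰h
    where
    detach : ∀ k {x y} → x ⇨ y ∈ ⟪ k ⟫ → x ∈ ⟪ k ⟫ → y ∈ ⟪ k ⟫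
    detach k p q = PrimeFilter.upClosed k (transpose-∧ refl) (PrimeFilter.∧-closed k p q)

  forest : Forest (c ⊔ ℓ₂) c c
  forest = record
    { decPoset = decPoset
    ; finite   = record
      { _≟_      = DecPoset._≟_ decPoset
      ; elements = principals elements
      ; complete = λ f → principals-complete f elements (generator f)
      }
    ; chain    = λ {f} {g} {h} → comparable f g h
    }

module Canonical {c ℓ₁ ℓ₂} (𝐀 : GAO c ℓ₁ ℓ₂) (finite : IsFinite (GAO.setoid 𝐀)) where
  open GAO 𝐀 hiding (Carrier; □_; ◇_)
  open GAO 𝐀 public using (Carrier; □_; ◇_)
  open PrimeFilters gödelAlgebra finite hiding (forest)
  open PrimeFilters gödelAlgebra finite public using (forest)
  open Downsets forest public using (Downset; ⟦_⟧; β; δ; Stable; complexGAO)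
  open IsFinite finite
  open Search setoid elements complete

  R□ : Relation forest c
  R□ = record
    { rel  = λ f₁ f₂ → (□_ ⊢ ⟪ f₁ ⟫) ⊆′ ⟪ f₂ ⟫
    ; dec  = λ f₁ f₂ → ∀?
        (λ x≈y h → ⟪ f₂ ⟫-resp x≈y ∘ h ∘ ⟪ f₁ ⟫-resp (□-cong (Eq.sym x≈y)))
        (λ x → ⟪ f₁ ⟫? (□ x) →-dec ⟪ f₂ ⟫? x)
    ; resp = (λ (p , _) h x → p x ∘ h x)
           , (λ (_ , q) h x → h x ∘ q (□ x))
    }

  R◇ : Relation forest c
  R◇ = record
    { rel  = λ f₁ f₂ → ⟪ f₂ ⟫ ⊆′ (◇_ ⊢ ⟪ f₁ ⟫)
    ; dec  = λ f₁ f₂ → ∀?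
        (λ x≈y h → ⟪ f₁ ⟫-resp (◇-cong x≈y) ∘ h ∘ ⟪ f₂ ⟫-resp (Eq.sym x≈y))
        (λ x → ⟪ f₂ ⟫? x →-dec ⟪ f₁ ⟫? (◇ x))
    ; resp = (λ (_ , q) h x → h x ∘ q x)
           , (λ (p , _) h x → p (◇ x) ∘ h x)
    }

  R : Relation forest c
  R = R□ ∩ʳ R◇

  r : Carrier → Downset
  r a = record
    { χ          = λ f → PrimeFilter.χ f a
    ; downClosed = λ g≤f → g≤f a
    }

{-# OPTIONS --safe #-}

-- A finite Gödel algebra is dual to its forest of prime filters because x ≰ y
-- is always witnessed by a prime filter containing x and not y.  Let f be a
-- prime filter, m the least element with □ m ∈ f and j the greatest element
-- with ◇ j ∉ f.  Then f R g says exactly that m ∈ g and j ∉ g.  If □ a ∉ f,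
-- the first Dunn axiom gives m ≰ a ∨ j, and if ◇ a ∈ f, the second gives
-- m ∧ a ≰ j; separating these pairs yields successors g of f under R, which are
-- in particular successors under R□ and R◇, with a ∉ g and a ∈ g respectively.

module Submission where

open import Algebra.Lattice.Morphism.Construct.Identity using (isLatticeIsomorphism)
open import Data.List.Base using (List; []; _∷_)
open import Data.List.Relation.Unary.Any using (here; there)
import Data.List.Membership.Setoid as ListMembership
open import Data.Product.Base using (∃; ∃-syntax; Σ-syntax; _×_; _,_; proj₁; proj₂)
open import Data.Sum.Base using (_⊎_; inj₁; inj₂; [_,_]′)
open import Function.Base using (id; _∘_)
open import Relation.Binary.Bundles using (Setoid)
import Relation.Binary.Construct.Flip.EqAndOrd as Flip
open import Relation.Binary.Core using (Rel)
open import Relation.Binary.Definitions using (_Respects_)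
import Relation.Binary.Lattice.Properties.HeytingAlgebra as HeytingProperties
open import Relation.Binary.Structures using (IsPreorder)
open import Relation.Nullary.Decidable
  using (yes; no; toWitness; fromWitness; ¬?; _→-dec_; decidable-stable)
open import Relation.Nullary.Negation using (¬_; contradiction)
open import Relation.Unary using (Pred; Decidable; _∈_; _∉_; _≐′_)
open import Relation.Unary.Properties using (≐′-trans)
open import Defs

-- Least elements of directed predicates on finite setoids.

module _ {a ℓ} (S : Setoid a ℓ) where
  open Setoid S using (Carrier; _≈_)
  open ListMembership S using () renaming (_∈_ to _∈ˡ_)

  module _ {p ℓ′} {P : Pred Carrier p} {_≲_ : Rel Carrier ℓ′}
           (isPreorder : IsPreorder _≈_ _≲_) (resp : P Respects _≈_) (P? : Decidable P)
           (inhabited : ∃ P)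
           (directed : ∀ {x y} → x ∈ P → y ∈ P → ∃[ z ] z ∈ P × z ≲ x × z ≲ y) where
    open IsPreorder isPreorder using (reflexive; trans; module Eq)

    lowerBound : ∀ xs → ∃[ m ] m ∈ P × (∀ {x} → x ∈ˡ xs → x ∈ P → m ≲ x)
    lowerBound [] = let e , e∈P = inhabited in e , e∈P , λ ()
    lowerBound (y ∷ xs) with P? y | lowerBound xs
    ... | no y∉P | m , m∈P , m≲ = m , m∈P , λ
      { (here x≈y)   x∈P → contradiction (resp x≈y x∈P) y∉P
      ; (there x∈xs) x∈P → m≲ x∈xs x∈P }
    ... | yes y∈P | m , m∈P , m≲ =
      let z , z∈P , z≲y , z≲m = directed y∈P m∈P in z , z∈P , λ
        { (here x≈y)   _   → trans z≲y (reflexive (Eq.sym x≈y))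
        ; (there x∈xs) x∈P → trans z≲m (m≲ x∈xs x∈P) }

    -- `elements` lists the whole carrier, so `lowerBound` becomes a global bound inside `P`. The
    -- order is a parameter so that flipping it yields greatest elements.
    least : IsFinite S → ∃[ m ] m ∈ P × (∀ {x} → x ∈ P → m ≲ x)
    least finite =
      let m , m∈P , m≲ = lowerBound elements in m , m∈P , λ {x} → m≲ (complete x)
      where open IsFinite finite

-- Prime filter separation and the representation by downsets.

module Duality {c ℓ₁ ℓ₂} (𝐀 : GödelAlgebra c ℓ₁ ℓ₂)
               (finite : IsFinite (GödelAlgebra.setoid 𝐀)) where
  open GödelAlgebra 𝐀
  open IsFinite finite
  open PrimeFilters 𝐀 finite hiding (poset)
  open ListMembership setoid using (find) renaming (_∈_ to _∈ˡ_)
  open Downsets forest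
  open HeytingProperties (GödelAlgebra.heytingAlgebra 𝐀)
    using (y≤x⇨y; ⇨-eval; swap-transpose-⇨)

  -- Both `y` and `z` lie below `x ⇨ y`, so `x ≤ y ∨ z` would give `x ≤ x ⇨ y` and then `x ≤ y`.
  -- This lets `split` join an element to `y` when meeting it with `x` would collapse the pair.
  ≰-∨ : ∀ {x y z} → ¬ (x ≤ y) → x ∧ z ≤ y → ¬ (x ≤ y ∨ z)
  ≰-∨ x≰y x∧z≤y x≤y∨z = x≰y (trans (∧-greatest x≤x⇨y refl) ⇨-eval)
    where
    x≤x⇨y = trans x≤y∨z (∨-least y≤x⇨y (swap-transpose-⇨ x∧z≤y))

  -- The pair (x , y) is enlarged to one whose upset and downset together
  -- cover the list; covering all of the algebra makes the upset prime.
  split : ∀ {x y} → ¬ (x ≤ y) → ∀ es →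
          ∃[ p ] ∃[ q ] p ≤ x × y ≤ q × ¬ (p ≤ q) × (∀ {z} → z ∈ˡ es → p ≤ z ⊎ z ≤ q)
  split {x} {y} x≰y [] = x , y , refl , refl , x≰y , λ ()
  split {x} {y} x≰y (e ∷ es) with (x ∧ e) ≤? y
  ... | yes x∧e≤y =
    let p , q , p≤x , y∨e≤q , p≰q , cover = split (≰-∨ x≰y x∧e≤y) es
    in p , q , p≤x , trans (x≤x∨y y e) y∨e≤q , p≰q , λ
      { (here z≈e)   → inj₂ (trans (reflexive z≈e) (trans (y≤x∨y y e) y∨e≤q))
      ; (there z∈es) → cover z∈es }
  ... | no x∧e≰y =
    let p , q , p≤x∧e , y≤q , p≰q , cover = split x∧e≰y es
    in p , q , trans p≤x∧e (x∧y≤x x e) , y≤q , p≰q , λ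
      { (here z≈e)   → inj₁ (trans p≤x∧e (≤-respʳ (Eq.sym z≈e) (x∧y≤y x e)))
      ; (there z∈es) → cover z∈es }

  -- Once every element is above `p` or below `q`, `p` is join-prime: if `u` and `v` were both below
  -- `q`, then `p ≤ u ∨ v` would force `p ≤ q`. The filter is the upset of `p`.
  separate : ∀ {x y} → ¬ (x ≤ y) → ∃[ f ] x ∈ ⟪ f ⟫ × y ∉ ⟪ f ⟫
  separate x≰y =
    let p , q , p≤x , y≤q , p≰q , cover = split x≰y elements
        jp = (λ p≤⊥ → p≰q (trans p≤⊥ (minimum q)))
           , (λ u v p≤u∨v → prime p≰q p≤u∨v (cover (complete u)) (cover (complete v)))
    in principal p jp
     , fromWitness {a? = p ≤? _} p≤x
     , λ y∈ → p≰q (trans (toWitness {a? = p ≤? _} y∈) y≤q)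
    where
    prime : ∀ {p q u v} → ¬ (p ≤ q) → p ≤ u ∨ v →
            p ≤ u ⊎ u ≤ q → p ≤ v ⊎ v ≤ q → p ≤ u ⊎ p ≤ v
    prime p≰q p≤u∨v (inj₁ p≤u) _          = inj₁ p≤u
    prime p≰q p≤u∨v (inj₂ _)   (inj₁ p≤v) = inj₂ p≤v
    prime p≰q p≤u∨v (inj₂ u≤q) (inj₂ v≤q) =
      contradiction (trans p≤u∨v (∨-least u≤q v≤q)) p≰q

  -- The map `r` of `Canonical`, restated without modal operators; the two unfold to the same
  -- downset, so facts about `rep` serve for `r`.
  rep : Carrier → Downset
  rep a = record
    { χ          = λ f → PrimeFilter.χ f a
    ; downClosed = λ g≤f → g≤f a
    }

  rep-mono : ∀ {x y} → x ≤ y → rep x ≤ᴳ rep y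
  rep-mono x≤y f = PrimeFilter.upClosed f x≤y

  rep-cancel : ∀ {x y} → rep x ≤ᴳ rep y → x ≤ y
  rep-cancel {x} {y} h = decidable-stable (x ≤? y) λ x≰y →
    let f , x∈f , y∉f = separate x≰y in y∉f (h f x∈f)

  rep-∧ : ∀ x y → rep (x ∧ y) ≈ᴳ (rep x ∩ᴳ rep y)
  rep-∧ x y =
      (λ f h → ∩⁺ (rep x) (rep y) f (rep-mono (x∧y≤x x y) f h , rep-mono (x∧y≤y x y) f h))
    , (λ f h → let x∈ , y∈ = ∩⁻ (rep x) (rep y) f h in PrimeFilter.∧-closed f x∈ y∈)

  rep-∨ : ∀ x y → rep (x ∨ y) ≈ᴳ (rep x ∪ᴳ rep y)
  rep-∨ x y =
      (λ f h → ∪⁺ (rep x) (rep y) f (PrimeFilter.prime f h))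
    , (λ f → [ rep-mono (x≤x∨y x y) f , rep-mono (y≤x∨y x y) f ]′ ∘ ∪⁻ (rep x) (rep y) f)

  rep-⊥ : rep ⊥ ≈ᴳ ∅ᴳ
  rep-⊥ = (λ f ⊥∈ → contradiction ⊥∈ (PrimeFilter.⊥∉ f)) , (λ _ ())

  rep-⊤ : rep ⊤ ≈ᴳ Uᴳ
  rep-⊤ = (λ _ _ → _) , (λ f _ → PrimeFilter.⊤∈ f)

  -- The preimage of d is the greatest x with rep x ⊆ d.
  rep-surjective : ∀ d → ∃[ x ] rep x ≈ᴳ d
  rep-surjective d =
    let x , x⊆d , ≤x = least setoid {P = λ x → rep x ≤ᴳ d} (Flip.isPreorder isPreorder)
          (λ x≈y x⊆d f → x⊆d f ∘ ⟪ f ⟫-resp (Eq.sym x≈y))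
          rep⊆d?
          (⊥ , λ f ⊥∈ → contradiction ⊥∈ (PrimeFilter.⊥∉ f))
          (λ {x} {y} x⊆d y⊆d → x ∨ y
            , (λ f → [ x⊆d f , y⊆d f ]′ ∘ PrimeFilter.prime f)
            , x≤x∨y x y , y≤x∨y x y)
          finite
    in x , x⊆d , λ f f∈d →
      -- A prime filter containing the generator `p` of `f` includes `f`, so it is below `f` in the
      -- forest and belongs to `d`. Hence `p ≤ x` by maximality, and `x ∈ f`.
      let p , _ , p∈f , p≤ = find (generator f)
          p⊆d : rep p ≤ᴳ d
          p⊆d g p∈g = Downset.downClosed d {g} {f}
            (λ y y∈f → PrimeFilter.upClosed g (p≤ y∈f) p∈g) f∈d
      in rep-mono (≤x p⊆d) f p∈f
    where
    module F = Forest forest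
    rep⊆d? : Decidable (λ x → rep x ≤ᴳ d)
    rep⊆d? x = Search.∀? F.Eq.setoid F.elements F.complete
      (λ {f} {g} f≈g h → ⟦ d ⟧-resp {f} {g} f≈g ∘ h ∘ proj₂ f≈g x)
      (λ f → ⟪ f ⟫? x →-dec ⟦ d ⟧? f)

  -- Implication is determined by order and meets. For the converse inclusion, the downset
  -- implication is pulled back to some `w`; residuation among downsets and `rep-cancel` then give
  -- `w ∧ x ≤ y`.
  rep-⇨ : ∀ x y → rep (x ⇨ y) ≈ᴳ (rep x ⇨ᴳ rep y)
  rep-⇨ x y =
      G.transpose-⇨ {rep (x ⇨ y)} {rep x} {rep y}
        (λ f → rep-mono ⇨-eval f ∘ proj₂ (rep-∧ (x ⇨ y) x) f)
    , (λ f f∈ → rep-mono w≤x⇨y f (proj₂ w≈ f f∈))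
    where
    module G = GödelAlgebra gödelAlgebra
    w  = proj₁ (rep-surjective (rep x ⇨ᴳ rep y))
    w≈ = proj₂ (rep-surjective (rep x ⇨ᴳ rep y))
    w≤x⇨y : w ≤ x ⇨ y
    w≤x⇨y = transpose-⇨ (rep-cancel λ f →
      G.transpose-∧ {rep w} {rep x} {rep y} (proj₁ w≈) f ∘ proj₁ (rep-∧ w x) f)

-- Modal operators of a finite Dunn algebra.

module DunnDuality {c ℓ₁ ℓ₂} (𝐀 : GAO c ℓ₁ ℓ₂) (finite : IsFinite (GAO.setoid 𝐀))
                   (dunn : IsDunn 𝐀) where
  open GAO 𝐀 hiding (□_; ◇_; Carrier)
  open Canonical 𝐀 finite
  open IsDunn dunn
  open PrimeFilters gödelAlgebra finite hiding (forest; poset)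
  open Duality gödelAlgebra finite
  open Downsets forest using (βᴳ⁺; βᴳ⁻; δᴳ⁺; δᴳ⁻)

  □-mono : ∀ {x y} → x ≤ y → □ x ≤ □ y
  □-mono {x} {y} x≤y =
    trans (reflexive (Eq.trans (□-cong (antisym (∧-greatest refl x≤y) (x∧y≤x x y))) (□-∧ x y)))
          (x∧y≤y _ _)

  ◇-mono : ∀ {x y} → x ≤ y → ◇ x ≤ ◇ y
  ◇-mono {x} {y} x≤y =
    trans (x≤x∨y _ _)
          (reflexive (Eq.trans (Eq.sym (◇-∨ x y)) (◇-cong (antisym (∨-least x≤y refl) (y≤x∨y x y)))))

  module _ (f : PrimeFilter) where
    open PrimeFilter f using (⊤∈; upClosed; ∧-closed; ⊥∉; prime)

    least-□ : ∃[ m ] □ m ∈ ⟪ f ⟫ × (∀ {x} → □ x ∈ ⟪ f ⟫ → m ≤ x)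
    least-□ = least setoid isPreorder
      (λ x≈y → ⟪ f ⟫-resp (□-cong x≈y)) (λ x → ⟪ f ⟫? (□ x))
      (⊤ , ⟪ f ⟫-resp (Eq.sym □-⊤) ⊤∈)
      (λ {x} {y} □x∈ □y∈ → x ∧ y
        , ⟪ f ⟫-resp (Eq.sym (□-∧ x y)) (∧-closed □x∈ □y∈) , x∧y≤x x y , x∧y≤y x y)
      finite

    -- The elements whose `◇` is outside `f` form an ideal; primality of `f` gives closure under
    -- joins.
    greatest-◇ : ∃[ j ] ◇ j ∉ ⟪ f ⟫ × (∀ {x} → ◇ x ∉ ⟪ f ⟫ → x ≤ j)
    greatest-◇ = least setoid (Flip.isPreorder isPreorder)
      (λ x≈y ◇x∉ → ◇x∉ ∘ ⟪ f ⟫-resp (◇-cong (Eq.sym x≈y))) (λ x → ¬? (⟪ f ⟫? (◇ x)))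
      (⊥ , ⊥∉ ∘ ⟪ f ⟫-resp ◇-⊥)
      (λ {x} {y} ◇x∉ ◇y∉ → x ∨ y
        , [ ◇x∉ , ◇y∉ ]′ ∘ prime ∘ ⟪ f ⟫-resp (◇-∨ x y) , x≤x∨y x y , y≤x∨y x y)
      finite

    private
      m   = proj₁ least-□
      □m∈ = proj₁ (proj₂ least-□)
      m≤  = proj₂ (proj₂ least-□)
      j   = proj₁ greatest-◇
      ◇j∉ = proj₁ (proj₂ greatest-◇)
      ≤j  = proj₂ (proj₂ greatest-◇)

    successor : ∀ g → m ∈ ⟪ g ⟫ → j ∉ ⟪ g ⟫ → Relation.rel R f g
    successor g m∈g j∉g =
        (λ x □x∈f → PrimeFilter.upClosed g (m≤ □x∈f) m∈g)
      , (λ x x∈g → decidable-stable (⟪ f ⟫? (◇ x)) λ ◇x∉f →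
          j∉g (PrimeFilter.upClosed g (≤j ◇x∉f) x∈g))

    □-witness : ∀ {a} → □ a ∉ ⟪ f ⟫ → ∃[ g ] Relation.rel R f g × a ∉ ⟪ g ⟫
    □-witness {a} □a∉ =
      let g , m∈g , a∨j∉g = separate m≰a∨j
      in g , successor g m∈g (a∨j∉g ∘ PrimeFilter.upClosed g (y≤x∨y a j))
           , a∨j∉g ∘ PrimeFilter.upClosed g (x≤x∨y a j)
      where
      m≰a∨j : ¬ (m ≤ a ∨ j)
      m≰a∨j m≤a∨j =
        -- Here `□ a ∨ ◇ j` is in `f`, so by primality one of two excluded elements is in `f`.
        [ □a∉ , ◇j∉ ]′ (prime (upClosed (trans (□-mono m≤a∨j) (□-dunn a j)) □m∈))

    ◇-witness : ∀ {a} → ◇ a ∈ ⟪ f ⟫ → ∃[ g ] a ∈ ⟪ g ⟫ × Relation.rel R f g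
    ◇-witness {a} ◇a∈ =
      let g , m∧a∈g , j∉g = separate m∧a≰j
      in g , PrimeFilter.upClosed g (x∧y≤y m a) m∧a∈g
           , successor g (PrimeFilter.upClosed g (x∧y≤x m a) m∧a∈g) j∉g
      where
      m∧a≰j : ¬ (m ∧ a ≤ j)
      m∧a≰j m∧a≤j =
        ◇j∉ (upClosed (trans (◇-dunn m a) (◇-mono m∧a≤j)) (∧-closed □m∈ ◇a∈))

  -- Three inclusions form a cycle; `□-witness` supplies the one from `β R` back to `r (□ a)`.
  r-□ : ∀ a → (⟦ r (□ a) ⟧ ≐′ β R□ (r a)) × (β R□ (r a) ≐′ β R (r a))
  r-□ a = (r⇒β□ , λ f → βR⇒r f ∘ β□⇒βR f) , (β□⇒βR , λ f → r⇒β□ f ∘ βR⇒r f)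
    where
    r⇒β□ : ∀ f → f ∈ ⟦ r (□ a) ⟧ → f ∈ β R□ (r a)
    r⇒β□ f □a∈f g s = s a □a∈f
    β□⇒βR : ∀ f → f ∈ β R□ (r a) → f ∈ β R (r a)
    β□⇒βR f h g (s , _) = h g s
    βR⇒r : ∀ f → f ∈ β R (r a) → f ∈ ⟦ r (□ a) ⟧
    βR⇒r f h = decidable-stable (⟪ f ⟫? (□ a)) λ □a∉f →
      let g , s , a∉g = □-witness f □a∉f in a∉g (h g s)

  -- The cycle runs through `δ R` first, since `δ` grows with its relation; `◇-witness` supplies the
  -- entry into `δ R`.
  r-◇ : ∀ a → (⟦ r (◇ a) ⟧ ≐′ δ R◇ (r a)) × (δ R◇ (r a) ≐′ δ R (r a))
  r-◇ a = ((λ f → δR⇒δ◇ f ∘ r⇒δR f) , δ◇⇒r) , ((λ f → r⇒δR f ∘ δ◇⇒r f) , δR⇒δ◇)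
    where
    r⇒δR : ∀ f → f ∈ ⟦ r (◇ a) ⟧ → f ∈ δ R (r a)
    r⇒δR f = ◇-witness f
    δR⇒δ◇ : ∀ f → f ∈ δ R (r a) → f ∈ δ R◇ (r a)
    δR⇒δ◇ f (g , a∈g , _ , s) = g , a∈g , s
    δ◇⇒r : ∀ f → f ∈ δ R◇ (r a) → f ∈ ⟦ r (◇ a) ⟧
    δ◇⇒r f (g , a∈g , s) = s a a∈g

  -- Every downset is some r x, so the identities for r x hold for all downsets.
  β-agree : ∀ d → β R□ d ≐′ β R d
  β-agree d =
      (λ f h g (s , _) → h g s)
    , (λ f h g s → proj₁ x≈d g
        (proj₂ (proj₂ (r-□ x)) f (λ z t → proj₂ x≈d z (h z t)) g s))
    where
    x   = proj₁ (rep-surjective d)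
    x≈d = proj₂ (rep-surjective d)

  δ-agree : ∀ d → δ R◇ d ≐′ δ R d
  δ-agree d =
      (λ f (z , z∈d , s) →
        let g , g∈ , t = proj₁ (proj₂ (r-◇ x)) f (z , proj₂ x≈d z z∈d , s)
        in g , proj₁ x≈d g g∈ , t)
    , (λ f (z , z∈d , _ , s) → z , z∈d , s)
    where
    x   = proj₁ (rep-surjective d)
    x≈d = proj₂ (rep-surjective d)

  -- Moving down the forest enlarges the filter, which shrinks the set of `R□`-successors and
  -- enlarges the set of `R◇`-successors.
  stable□◇ : Stable R□ R◇
  stable□◇ = record
    { β↓ = λ a g≤f h z s → h z (λ x → s x ∘ g≤f (□ x))
    ; δ↓ = λ a g≤f (z , z∈a , s) → z , z∈a , λ x → g≤f (◇ x) ∘ s x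
    }

  -- `R` mixes these two opposite monotonicities, so closure is transported from `R□` and `R◇` by
  -- the agreement on all downsets.
  stableR : Stable R R
  stableR = record
    { β↓ = λ a {g} {f} g≤f → proj₁ (β-agree a) g
         ∘ Stable.β↓ stable□◇ a {g} {f} g≤f ∘ proj₂ (β-agree a) f
    ; δ↓ = λ a {g} {f} g≤f → proj₁ (δ-agree a) g
         ∘ Stable.δ↓ stable□◇ a {g} {f} g≤f ∘ proj₂ (δ-agree a) f
    }

  -- Only the two modal clauses depend on the relations, so one construction covers both complex
  -- algebras.
  r-iso : ∀ {ℓ ℓ′} (S : Relation forest ℓ) (S′ : Relation forest ℓ′) (s : Stable S S′) →
          (∀ a → ⟦ r (□ a) ⟧ ≐′ β S (r a)) → (∀ a → ⟦ r (◇ a) ⟧ ≐′ δ S′ (r a)) →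
          IsGAOIsomorphism 𝐀 (complexGAO S S′ s) r
  r-iso S S′ s □≐ ◇≐ = record
    { isLatticeIsomorphism = record
      { isLatticeMonomorphism = record
        { isLatticeHomomorphism = record
          { isRelHomomorphism = record
            { cong = λ x≈y → rep-mono (reflexive x≈y) , rep-mono (reflexive (Eq.sym x≈y)) }
          ; ∧-homo = rep-∧
          ; ∨-homo = rep-∨
          }
        ; injective = λ (p , q) → antisym (rep-cancel p) (rep-cancel q)
        }
      ; surjective = λ d → let x , p , q = rep-surjective d in
          x , λ z≈x → (λ f → p f ∘ rep-mono (reflexive z≈x) f)
                    , (λ f → rep-mono (reflexive (Eq.sym z≈x)) f ∘ q f)
      }
    ; ⇨-homo = rep-⇨
    ; ⊥-homo = rep-⊥
    ; ⊤-homo = rep-⊤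
    ; □-homo = λ a → (λ f → βᴳ⁺ S S′ s (r a) f ∘ proj₁ (□≐ a) f)
                   , (λ f → proj₂ (□≐ a) f ∘ βᴳ⁻ S S′ s (r a) f)
    ; ◇-homo = λ a → (λ f → δᴳ⁺ S S′ s (r a) f ∘ proj₁ (◇≐ a) f)
                   , (λ f → proj₂ (◇≐ a) f ∘ δᴳ⁻ S S′ s (r a) f)
    }

  id-iso : IsGAOIsomorphism (complexGAO R□ R◇ stable□◇) (complexGAO R R stableR) id
  id-iso = record
    { isLatticeIsomorphism = isLatticeIsomorphism 𝐆.rawLattice (λ {a} → 𝐆.Eq.refl {a})
    ; ⇨-homo = λ a b → 𝐆.Eq.refl {a 𝐆.⇨ b}
    ; ⊥-homo = 𝐆.Eq.refl {𝐆.⊥}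
    ; ⊤-homo = 𝐆.Eq.refl {𝐆.⊤}
    ; □-homo = λ a →
          (λ f → βᴳ⁺ R R stableR a f ∘ proj₁ (β-agree a) f ∘ βᴳ⁻ R□ R◇ stable□◇ a f)
        , (λ f → βᴳ⁺ R□ R◇ stable□◇ a f ∘ proj₂ (β-agree a) f ∘ βᴳ⁻ R R stableR a f)
    ; ◇-homo = λ a →
          (λ f → δᴳ⁺ R R stableR a f ∘ proj₁ (δ-agree a) f ∘ δᴳ⁻ R□ R◇ stable□◇ a f)
        , (λ f → δᴳ⁺ R□ R◇ stable□◇ a f ∘ proj₂ (δ-agree a) f ∘ δᴳ⁻ R R stableR a f)
    }
    where
    module 𝐆 = GAO (complexGAO R□ R◇ stable□◇)

theorem5p4 : ∀ {c ℓ₁ ℓ₂} (𝐀 : GAO c ℓ₁ ℓ₂) (finite : IsFinite (GAO.setoid 𝐀)) → IsDunn 𝐀 →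
    let open Canonical 𝐀 finite in
    Σ[ s ∈ Stable R□ R◇ ] Σ[ s′ ∈ Stable R R ]
    ( IsGAOIsomorphism 𝐀 (complexGAO R□ R◇ s) r
    × IsGAOIsomorphism 𝐀 (complexGAO R R s′) r
    × IsGAOIsomorphism (complexGAO R□ R◇ s) (complexGAO R R s′) id
    × (∀ (a : Carrier) → (⟦ r (□ a) ⟧ ≐′ β R□ (r a)) × (β R□ (r a) ≐′ β R (r a)))
    × (∀ (a : Carrier) → (⟦ r (◇ a) ⟧ ≐′ δ R◇ (r a)) × (δ R◇ (r a) ≐′ δ R (r a))) )
theorem5p4 𝐀 finite dunn =
    stable□◇ , stableR
  , r-iso R□ R◇ stable□◇ (proj₁ ∘ r-□) (proj₁ ∘ r-◇)
  , r-iso R R stableR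
      (λ a → let r≐ , ≐R = r-□ a in ≐′-trans r≐ ≐R)
      (λ a → let r≐ , ≐R = r-◇ a in ≐′-trans r≐ ≐R)
  , id-iso
  , r-□
  , r-◇
  where
  open Canonical 𝐀 finite
  open DunnDuality 𝐀 finite dunn
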